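{- For every graph $G$, $\mathsf{tree}\text{ - }\alpha(G)\le \mathrm{tw}(G)+1$, and this bound is sharp: for every positive integer $k\neq 2$, there exists a graph $G$ such that $\mathsf{tree}\text{ - }\alpha(G)=k$ and $\mathrm{tw}(G)=k-1$.
   Context: All graphs are finite, simple, and undirected. A tree decomposition of a graph $G$ is a pair $\mathcal{T}=(T,\{X_t\}_{t\in V(T)})$ where $T$ is a tree and each node $t$ is assigned a bag $X_t\subseteq V(G)$ such that every vertex of $G$ is in at least one bag, every edge of $G$ has both endpoints in some common bag, and for every $u\in V(G)$ the subgraph of $T$ induced by $\{t: u\in X_t\}$ is connected. Its width is $\max_t|X_t|-1$, and the treewidth $\mathrm{tw}(G)$ is the minimum width of a tree decomposition of $G$. The independence number of $\mathcal{T}$ is $\alpha(\mathcal{T})=\max_{t\in V(T)}\alpha(G[X_t])$, where $\alpha(H)$ is the maximum size of an independent set in $H$. The tree-independence number $\mathsf{tree}\text{ - }\alpha(G)$ is the minimum of $\alpha(\mathcal{T})$ over all tree decompositions $\mathcal{T}$ of $G$. -}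

module Defs where

open import Data.Empty using (⊥)
open import Data.Fin.Base using (Fin; zero)
open import Data.Fin.Properties using (all?)
open import Data.Fin.Subset using (Subset; inside; outside; ⊤; _∈_; ∣_∣)
open import Data.Fin.Subset.Properties using (_∈?_; _⊆?_; ∈⊤)
open import Data.Integer.Base as ℤ using (ℤ; +_; 1ℤ)
import Data.Integer.Properties as ℤₚ
open import Data.List.Base using (List; []; _∷_; [_]; _++_; _∷ʳ_; map; filter; length; allFin)
open import Data.List.Extrema.Nat using (max)
open import Data.List.Relation.Unary.Linked using (Linked; _∷_)
open import Data.List.Relation.Unary.Unique.Propositional using (Unique)
open import Data.Nat.Base as ℕ using (ℕ; zero; suc)
import Data.Nat.Properties as ℕₚ
open import Data.Product.Base using (Σ; ∃; _×_; _,_; proj₁)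
open import Data.Vec.Base as Vec using ()
open import Data.Vec.Properties.WithK using ([]=-irrelevant)
open import Function.Base using (_∘_; _on_)
open import Level using (_⊔_; 0ℓ)
open import Relation.Binary.Construct.Closure.ReflexiveTransitive using (Star; ε)
open import Relation.Binary.Core using (Rel)
open import Relation.Binary.Definitions using (Decidable; Symmetric; Irreflexive)
open import Relation.Binary.PropositionalEquality.Core using (_≡_; refl; cong; subst)
open import Relation.Nullary.Decidable using (Dec; no; ¬?; _→-dec_; _×-dec_)
open import Relation.Nullary.Negation.Core using (¬_)

record Graph : Set₁ where
  infix 4 _~_ _~?_
  field
    order  : ℕ

  Vertex : Set
  Vertex = Fin order

  field
    _~_    : Rel Vertex 0ℓ
    _~?_   : Decidable _~_
    sym    : Symmetric _~_
    irrefl : Irreflexive _≡_ _~_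

open Graph using (Vertex; order)

-- Any two elements are joined by an R-walk; nonemptiness is not included.
Connected : {A : Set} → Rel A 0ℓ → Set
Connected R = ∀ x y → Star R x y

-- The cycle v, v₁, …, vₘ, v with m ≥ 2 and v, v₁, …, vₘ pairwise distinct.
record Cycle (G : Graph) : Set where
  open Graph G using (_~_)
  field
    base     : Vertex G
    rest     : List (Vertex G)
    long     : 2 ℕ.≤ length rest
    distinct : Unique (base ∷ rest)
    closed   : Linked _~_ (base ∷ (rest ∷ʳ base))

record IsTree (T : Graph) : Set where
  field
    nonempty  : Vertex T
    connected : Connected (Graph._~_ T)
    acyclic   : ¬ Cycle T

record TreeDecomposition (G : Graph) : Set₁ where
  open Graph G using (_~_)
  field
    tree   : Graph
    isTree : IsTree tree
    bag    : Vertex tree → Subset (order G)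

  -- The nodes of the subgraph of the tree induced by { t : u ∈ bag t }.
  NodesOf : Vertex G → Set
  NodesOf u = Σ (Vertex tree) λ t → u ∈ bag t

  field
    vertexCovered : ∀ u → ∃ λ t → u ∈ bag t
    edgeCovered   : ∀ {u v} → u ~ v → ∃ λ t → u ∈ bag t × v ∈ bag t
    bagsConnected : ∀ u → Connected {NodesOf u} (Graph._~_ tree on proj₁)

Independent : (G : Graph) → Subset (order G) → Set
Independent G S = ∀ u v → u ∈ S → v ∈ S → ¬ (Graph._~_ G u v)

independent? : ∀ G S → Dec (Independent G S)
independent? G S = all? λ u → all? λ v →
  (u ∈? S) →-dec ((v ∈? S) →-dec ¬? (Graph._~?_ G u v))

allSubsets : ∀ n → List (Subset n)
allSubsets zero    = [ Vec.[] ]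
allSubsets (suc n) =
  map (outside Vec.∷_) (allSubsets n) ++ map (inside Vec.∷_) (allSubsets n)

-- α(G[X]): the independent sets of the induced subgraph G[X] are exactly the
-- independent sets of G contained in X.
α[_] : (G : Graph) → Subset (order G) → ℕ
α[ G ] X = max 0 (map ∣_∣
  (filter (λ S → (S ⊆? X) ×-dec independent? G S) (allSubsets (order G))))

module _ {G : Graph} (𝒯 : TreeDecomposition G) where
  open TreeDecomposition 𝒯

  maxBagSize : ℕ
  maxBagSize = max 0 (map (∣_∣ ∘ bag) (allFin (order tree)))

  -- Integer-valued: the empty graph has a decomposition of width -1.
  width : ℤ
  width = + maxBagSize ℤ.- 1ℤ

  independenceNumber : ℕ
  independenceNumber = max 0 (map (α[ G ] ∘ bag) (allFin (order tree)))

-- x is the minimum of f over D.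
IsMinimumOf : ∀ {d a ℓ} {D : Set d} {A : Set a} → Rel A ℓ → (D → A) → A → Set (d ⊔ a ⊔ ℓ)
IsMinimumOf _≤_ f x = (∃ λ i → f i ≡ x) × (∀ i → x ≤ f i)

-- Treewidth and tree-independence number are given by their graphs
-- "tw(G) = w" and "tree-α(G) = k": the minima range over infinitely many tree
-- decompositions, so they are not computed by enumeration.  The values are
-- unique by antisymmetry of ≤, and exist (classically) by ¬¬∃-treewidth and
-- ¬¬∃-treeAlpha below.
IsTreewidth : Graph → ℤ → Set₁
IsTreewidth G w = IsMinimumOf ℤ._≤_ (width {G}) w

IsTreeAlpha : Graph → ℕ → Set₁
IsTreeAlpha G k = IsMinimumOf ℕ._≤_ (independenceNumber {G}) k

trivialDecomposition : ∀ G → TreeDecomposition G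
trivialDecomposition G = record
  { tree          = record
    { order = 1 ; _~_ = λ _ _ → ⊥ ; _~?_ = λ _ _ → no λ () ; sym = λ () ; irrefl = λ _ () }
  ; isTree        = record
    { nonempty = zero ; connected = λ { zero zero → ε } ; acyclic = acyclic }
  ; bag           = λ _ → ⊤
  ; vertexCovered = λ _ → zero , ∈⊤
  ; edgeCovered   = λ _ → zero , ∈⊤ , ∈⊤
  ; bagsConnected = λ { u (zero , p) (zero , q) →
                        subst (λ r → Star _ (zero , p) (zero , r)) ([]=-irrelevant p q) ε }
  }
  where
  acyclic : ¬ Cycle _
  acyclic record { rest = [] ; long = () }
  acyclic record { rest = _ ∷ _ ; closed = () ∷ _ }

¬¬∃-minimum : ∀ {d} {D : Set d} (f : D → ℕ) → D → ¬ ¬ ∃ (IsMinimumOf ℕ._≤_ f)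
¬¬∃-minimum f i ∄min = noneBelow (suc (f i)) i ℕₚ.≤-refl
  where
  noneBelow : ∀ n j → ¬ (f j ℕ.< n)
  noneBelow (suc n) j fj<1+n = ∄min (f j , (j , refl) , λ l →
    ℕₚ.≮⇒≥ λ fl<fj → noneBelow n l (ℕₚ.≤-trans fl<fj (ℕ.s≤s⁻¹ fj<1+n)))

¬¬∃-treeAlpha : ∀ G → ¬ ¬ ∃ (IsTreeAlpha G)
¬¬∃-treeAlpha G = ¬¬∃-minimum independenceNumber (trivialDecomposition G)

¬¬∃-treewidth : ∀ G → ¬ ¬ ∃ (IsTreewidth G)
¬¬∃-treewidth G ∄tw = ¬¬∃-minimum maxBagSize (trivialDecomposition G)
  λ { (m , (𝒯 , eq) , least) → ∄tw
      ( + m ℤ.- 1ℤ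
      , (𝒯 , cong (λ n → + n ℤ.- 1ℤ) eq)
      , λ 𝒮 → ℤₚ.+-monoˡ-≤ (ℤ.- 1ℤ) (ℤ.+≤+ (least 𝒮)) ) }

{-# OPTIONS --safe #-}
-- Take k pairwise nonadjacent hubs and, for every pair of hubs, k common
-- neighbours of degree two (links).  The hubs form one bag, and each link hangs
-- off it in a bag of size three, so the treewidth is at most k − 1 for k ≥ 3, and
-- also for k = 1, where there are no links.
-- Conversely, in any tree decomposition either all pairs of hubs share a bag,
-- and by the Helly property of subtrees some bag contains all k hubs; or two
-- hubs share no bag, and then the subtrees of their k common neighbours
-- intersect pairwise (as both cross the gap between the two hubs), so again by
-- Helly some bag contains these k links.  Both sets are independent.
module Submission where

open import Defs
open import Data.Nat.Base as ℕ using (ℕ)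
open import Data.Integer.Base as ℤ using (ℤ; +_; 1ℤ)
open import Data.Product.Base using (Σ; _×_)
open import Relation.Binary.PropositionalEquality.Core using (_≢_)
open import Data.Empty using (⊥)
open import Data.Fin.Base using (Fin; zero; suc; _↑ˡ_; _↑ʳ_; splitAt; combine; remQuot)
open import Data.Fin.Properties using (_≟_; all?; any?; suc-injective; ↑ˡ-injective; ↑ʳ-injective; splitAt-↑ˡ; splitAt-↑ʳ; splitAt⁻¹-↑ˡ; splitAt⁻¹-↑ʳ; remQuot-combine; combine-injectiveʳ; ¬∀⟶∃¬)
open import Data.Fin.Subset as Subset using (Subset; ⁅_⁆; ∣_∣; _∈_; _⊆_)
open import Data.Fin.Subset.Properties using (_∈?_; ∉⊥; ∣⊥∣≡0; x∈⁅x⁆; x∈⁅y⁆⇒x≡y; x∈p∪q⁻; x∈p∪q⁺; ∪-identityˡ; ∣p∣≤∣x∷p∣; p⊆q⇒∣p∣≤∣q∣; x∈p∧x≢y⇒x∈p-y; x∈p⇒∣p-x∣<∣p∣; _⊆?_)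
import Data.Integer.Properties as ℤₚ
open import Data.List.Base using (List; []; _∷_; _∷ʳ_; allFin)
open import Data.List.Extrema.Nat using (max≤v⁺; v≤max⁺)
open import Data.List.Membership.Propositional using (lose) renaming (_∈_ to _∈ₗ_)
open import Data.List.Membership.DecPropositional using () renaming (_∈?_ to ∈ₗ-dec)
open import Data.List.Membership.Propositional.Properties using (∈-map⁺; ∈-++⁺ˡ; ∈-++⁺ʳ; ∈-filter⁺; ∈-allFin)
open import Data.List.Relation.Unary.All as All using ([]; _∷_)
open import Data.List.Relation.Unary.All.Properties as All using (¬Any⇒All¬)
open import Data.List.Relation.Unary.AllPairs using ([]; _∷_)
open import Data.List.Relation.Unary.Any using (here; there)
open import Data.List.Relation.Unary.Linked using (Linked; [-]; _∷_)
open import Data.List.Relation.Unary.Unique.Propositional using (Unique)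
import Data.Nat.Properties as ℕₚ
open import Data.Product.Base using (∃; _,_; proj₁; proj₂)
open import Data.Sum.Base using (_⊎_; inj₁; inj₂)
open import Data.Unit.Base using (⊤; tt)
open import Data.Vec.Base as Vec using (_∷_; [])
open import Data.Vec.Properties.WithK using ([]=-irrelevant)
open import Function.Base using (_∘_; _on_; id)
open import Function.Definitions using (Injective)
open import Level using (0ℓ)
open import Relation.Binary.Construct.Closure.ReflexiveTransitive as Star using (Star; ε; _◅_; _◅◅_)
open import Relation.Binary.Core using (Rel)
open import Relation.Binary.Definitions using (DecidableEquality)
open import Relation.Binary.PropositionalEquality using (_≡_; refl; sym; trans; cong; subst)
open import Relation.Nullary.Decidable using (Dec; yes; no; _×-dec_; _⊎-dec_)
open import Relation.Nullary.Negation using (¬_; contradiction)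
open import Relation.Unary using (Pred; Decidable; _∩_; _∪_; ∁)

-- Simple paths

data Path {A : Set} (R : Rel A 0ℓ) : A → A → List A → Set where
  []  : ∀ {x} → Path R x x []
  _∷_ : ∀ {x y z ys} → R x y → Path R y z ys → Path R x z (y ∷ ys)

module _ {A : Set} {R : Rel A 0ℓ} where

  suffixPath : ∀ {v x z ys} → Path R x z ys → Unique (x ∷ ys) → v ∈ₗ x ∷ ys →
               ∃ λ zs → Path R v z zs × Unique (v ∷ zs)
  suffixPath p       u       (here refl) = _ , p , u
  suffixPath (_ ∷ p) (_ ∷ u) (there v∈)  = suffixPath p u v∈

  -- Loop erasure: when the source already occurs on the path built so far, only the suffix from
  -- that occurrence is kept. `Cycle` asks for distinct vertices, so walks must be thinned first.
  simplePath : DecidableEquality A → ∀ {x z} → Star R x z →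
               ∃ λ ys → Path R x z ys × Unique (x ∷ ys)
  simplePath _≈?_ ε = [] , [] , [] ∷ []
  simplePath _≈?_ {x} (_◅_ {j = y} r w) with simplePath _≈?_ w
  ... | ys , p , u with ∈ₗ-dec _≈?_ x (y ∷ ys)
  ...   | yes x∈ = suffixPath p u x∈
  ...   | no  x∉ = y ∷ ys , r ∷ p , ¬Any⇒All¬ _ x∉ ∷ u

  closePath : ∀ {S : Rel A 0ℓ} → (∀ {a b} → R a b → S a b) →
              ∀ {x z ys v} → Path R x z ys → S z v → Linked S (x ∷ (ys ∷ʳ v))
  closePath R⇒S []      s = s ∷ [-]
  closePath R⇒S (r ∷ p) s = R⇒S r ∷ closePath R⇒S p s

-- Subtrees

module _ {A : Set} (R : Rel A 0ℓ) where

  Within : Pred A 0ℓ → Rel A 0ℓ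
  Within P x y = P x × R x y × P y

  ConnectedSet : Pred A 0ℓ → Set
  ConnectedSet P = ∀ {x y} → P x → P y → Star (Within P) x y

module _ {A : Set} {R : Rel A 0ℓ} where

  weaken : ∀ {P Q : Pred A 0ℓ} → (∀ {x} → P x → Q x) →
           ∀ {x y} → Star (Within R P) x y → Star (Within R Q) x y
  weaken P⊆Q = Star.map λ (px , r , py) → P⊆Q px , r , P⊆Q py

  ∪-connected : ∀ {P Q : Pred A 0ℓ} → ConnectedSet R P → ConnectedSet R Q →
                ∃ (P ∩ Q) → ConnectedSet R (P ∪ Q)
  ∪-connected cP cQ (z , pz , qz) (inj₁ px) (inj₁ py) = weaken inj₁ (cP px py)
  ∪-connected cP cQ (z , pz , qz) (inj₁ px) (inj₂ qy) = weaken inj₁ (cP px pz) ◅◅ weaken inj₂ (cQ qz qy)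
  ∪-connected cP cQ (z , pz , qz) (inj₂ qx) (inj₁ py) = weaken inj₂ (cQ qx qz) ◅◅ weaken inj₁ (cP pz py)
  ∪-connected cP cQ (z , pz , qz) (inj₂ qx) (inj₂ qy) = weaken inj₂ (cQ qx qy)

-- Bridges and the Helly property in trees

module _ {T : Graph} (isTree : IsTree T) where
  open Graph T using (_~_; Vertex) renaming (irrefl to ~-irrefl)
  open IsTree isTree

  OtherThan : Vertex → Vertex → Rel Vertex 0ℓ
  OtherThan y x a b = a ~ b × ¬ (a ≡ y × b ≡ x)

  -- A simple path from `y` to `x` is neither empty, as `x ~ y`, nor the single excluded step; any
  -- longer one is closed to a cycle by the edge `x ~ y`.
  bridge : ∀ {x y} → x ~ y → ¬ Star (OtherThan y x) y x
  bridge x~y w with simplePath _≟_ w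
  ... | []         , []               , _ = ~-irrefl refl x~y
  ... | _ ∷ []     , (_ , ≢yx) ∷ []   , _ = ≢yx (refl , refl)
  ... | _ ∷ _ ∷ _  , p                , u = acyclic record
    { long = ℕ.s≤s (ℕ.s≤s ℕ.z≤n) ; distinct = u ; closed = closePath proj₁ p x~y }

  avoidSource : ∀ {P : Pred Vertex 0ℓ} {x y} → ¬ P y →
                ∀ {a b} → Star (Within _~_ P) a b → Star (OtherThan y x) a b
  avoidSource ¬py = Star.map λ { (pa , r , _) → r , λ { (refl , _) → ¬py pa } }

  avoidTarget : ∀ {P : Pred Vertex 0ℓ} {x y} → ¬ P x →
                ∀ {a b} → Star (Within _~_ P) a b → Star (OtherThan y x) a b
  avoidTarget ¬px = Star.map λ { (_ , r , pb) → r , λ { (_ , refl) → ¬px pb } }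

  -- On a walk inside P from Q ∩ P to P ∩ S, the edge by which the walk leaves Q
  -- for good would be bypassed through S and Q if its endpoint in Q were not in S.
  helly₃ : ∀ {P Q S : Pred Vertex 0ℓ} → Decidable Q → Decidable S →
           ConnectedSet _~_ P → ConnectedSet _~_ Q → ConnectedSet _~_ S →
           ∃ (P ∩ Q) → ∃ (P ∩ S) → ∃ (Q ∩ S) → ∃ (P ∩ (Q ∩ S))
  helly₃ {P} {Q} {S} Q? S? cP cQ cS (b , pb , qb) (c , pc , sc) (a , qa , sa)
    with search (cP pb pc)
    where
    search : ∀ {x} → Star (Within _~_ P) x c →
             ∃ (P ∩ (Q ∩ S)) ⊎ (¬ Q x × Star (Within _~_ (∁ Q)) x c)
    search ε with Q? c
    ... | yes qc = inj₁ (c , pc , qc , sc)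
    ... | no ¬qc = inj₂ (¬qc , ε)
    search {x} ((px , x~y , py) ◅ w) with search w
    ... | inj₁ found = inj₁ found
    ... | inj₂ (¬qy , v) with Q? x | S? x
    ...   | no ¬qx | _      = inj₂ (¬qx , (¬qx , x~y , ¬qy) ◅ v)
    ...   | yes qx | yes sx = inj₁ (x , px , qx , sx)
    ...   | yes qx | no ¬sx = contradiction
      (avoidTarget (λ ¬qx → ¬qx qx) v ◅◅ avoidTarget ¬sx (cS sc sa) ◅◅ avoidSource ¬qy (cQ qa qx))
      (bridge x~y)
  ... | inj₁ found     = found
  ... | inj₂ (¬qb , _) = contradiction qb ¬qb

  -- If a walk inside P leaves Q at x, then it first re-enters Q at x: otherwise
  -- the edge by which it leaves is bypassed by the excursion and a walk in Q.
  ∩-connected : ∀ {P Q : Pred Vertex 0ℓ} → Decidable Q →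
                ConnectedSet _~_ P → ConnectedSet _~_ Q → ConnectedSet _~_ (P ∩ Q)
  ∩-connected {P} {Q} Q? cP cQ {x₀} {y₀} (px₀ , qx₀) (py₀ , qy₀) with retract (cP px₀ py₀)
    where
    -- Along a walk of such steps ending at `z`, the vertex `z` is where `Q` is first entered.
    Excursion : Vertex → Rel Vertex 0ℓ
    Excursion z a b = a ~ b × (Q b → b ≡ z)

    retract : ∀ {x} → Star (Within _~_ P) x y₀ →
              (Q x × Star (Within _~_ (P ∩ Q)) x y₀)
              ⊎ (¬ Q x × ∃ λ z → Q z × Star (Excursion z) x z × Star (Within _~_ (P ∩ Q)) z y₀)
    retract ε = inj₁ (qy₀ , ε)
    retract {x} ((px , x~y , py) ◅ w) with Q? x | retract w
    ... | yes qx | inj₁ (qy , v) = inj₁ (qx , ((px , qx) , x~y , (py , qy)) ◅ v)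
    ... | no ¬qx | inj₁ (qy , v) = inj₂ (¬qx , _ , qy , (x~y , λ _ → refl) ◅ ε , v)
    ... | no ¬qx | inj₂ (¬qy , z , qz , u , v) =
      inj₂ (¬qx , z , qz , (x~y , λ qy → contradiction qy ¬qy) ◅ u , v)
    ... | yes qx | inj₂ (¬qy , z , qz , u , v) with z ≟ x
    ...   | yes refl = inj₁ (qx , v)
    ...   | no  z≢x  = contradiction
      (Star.map (λ { (r , q⇒) → r , λ { (_ , refl) → z≢x (sym (q⇒ qx)) } }) u
        ◅◅ avoidSource ¬qy (cQ qz qx))
      (bridge x~y)
  ... | inj₁ (_ , v)    = v
  ... | inj₂ (¬qx₀ , _) = contradiction qx₀ ¬qx₀

  -- Induction with `P` as the intersection of the sets already treated: `∩-connected` keeps it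
  -- connected, and `helly₃` makes it meet each remaining set.
  helly-relative : ∀ {n} {P : Pred Vertex 0ℓ} (S : Fin n → Pred Vertex 0ℓ) →
                   (∀ i → Decidable (S i)) →
                   ConnectedSet _~_ P → (∀ i → ConnectedSet _~_ (S i)) →
                   ∃ P → (∀ i → ∃ (P ∩ S i)) → (∀ i j → ∃ (S i ∩ S j)) →
                   ∃ λ t → P t × ∀ i → S i t
  helly-relative {ℕ.zero}  S S? cP cS (t , pt) _  _  = t , pt , λ ()
  helly-relative {ℕ.suc n} S S? cP cS _        PS SS
    with helly-relative (S ∘ suc) (S? ∘ suc)
           (∩-connected (S? zero) cP (cS zero)) (cS ∘ suc) (PS zero)
           (λ i → let t , p , s₀ , sᵢ = helly₃ (S? zero) (S? (suc i)) cP (cS zero) (cS (suc i))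
                                          (PS zero) (PS (suc i)) (SS zero (suc i))
                  in t , (p , s₀) , sᵢ)
           (λ i j → SS (suc i) (suc j))
  ... | t , (pt , s₀) , s = t , pt , λ { zero → s₀ ; (suc i) → s i }

  helly : ∀ {n} (S : Fin n → Pred Vertex 0ℓ) → (∀ i → Decidable (S i)) →
          (∀ i → ConnectedSet _~_ (S i)) → (∀ i j → ∃ (S i ∩ S j)) →
          ∃ λ t → ∀ i → S i t
  helly S S? cS SS
    with helly-relative {P = λ _ → ⊤} S S?
           (λ _ _ → Star.map (λ r → tt , r , tt) (connected _ _)) cS (nonempty , tt)
           (λ i → let t , s , _ = SS i i in t , tt , s) SS
  ... | t , _ , s = t , s

  -- `helly₃` is applied to `A ∪ P`, `B` and `Q`: the common node lies in `B`, hence not in `A`,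
  -- hence in `P`.
  crossing-meet : ∀ {A B P Q : Pred Vertex 0ℓ} → Decidable B → Decidable Q →
                  ConnectedSet _~_ A → ConnectedSet _~_ B → ConnectedSet _~_ P → ConnectedSet _~_ Q →
                  ¬ ∃ (A ∩ B) → ∃ (A ∩ P) → ∃ (B ∩ P) → ∃ (A ∩ Q) → ∃ (B ∩ Q) → ∃ (P ∩ Q)
  crossing-meet B? Q? cA cB cP cQ A∩B=∅ AP (t , bt , pt) (t′ , at′ , qt′) BQ
    with helly₃ B? Q? (∪-connected cA cP AP) cB cQ (t , inj₂ pt , bt) (t′ , inj₁ at′ , qt′) BQ
  ... | u , inj₁ au , bu , _  = contradiction (u , au , bu) A∩B=∅
  ... | u , inj₂ pu , _  , qu = u , pu , qu

-- Images of functions between finite sets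

image : ∀ {m n} → (Fin m → Fin n) → Subset n
image {ℕ.zero}  f = Subset.⊥
image {ℕ.suc m} f = ⁅ f zero ⁆ Subset.∪ image (f ∘ suc)

image⁺ : ∀ {m n} (f : Fin m → Fin n) i → f i ∈ image f
image⁺ f zero    = x∈p∪q⁺ (inj₁ (x∈⁅x⁆ _))
image⁺ f (suc i) = x∈p∪q⁺ (inj₂ (image⁺ (f ∘ suc) i))

image⁻ : ∀ {m n} (f : Fin m → Fin n) {x} → x ∈ image f → ∃ λ i → x ≡ f i
image⁻ {ℕ.zero}  f x∈ = contradiction x∈ ∉⊥
image⁻ {ℕ.suc m} f x∈ with x∈p∪q⁻ ⁅ f zero ⁆ _ x∈
... | inj₁ x∈₀ = zero , x∈⁅y⁆⇒x≡y _ x∈₀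
... | inj₂ x∈₁ = let i , eq = image⁻ (f ∘ suc) x∈₁ in suc i , eq

∣⁅x⁆∪p∣≤1+∣p∣ : ∀ {n} (x : Fin n) p → ∣ ⁅ x ⁆ Subset.∪ p ∣ ℕ.≤ ℕ.suc ∣ p ∣
∣⁅x⁆∪p∣≤1+∣p∣ zero    (s ∷ p) rewrite ∪-identityˡ p = ℕ.s≤s (∣p∣≤∣x∷p∣ s p)
∣⁅x⁆∪p∣≤1+∣p∣ (suc x) (Subset.inside  ∷ p) = ℕ.s≤s (∣⁅x⁆∪p∣≤1+∣p∣ x p)
∣⁅x⁆∪p∣≤1+∣p∣ (suc x) (Subset.outside ∷ p) = ∣⁅x⁆∪p∣≤1+∣p∣ x p

∣image∣≤ : ∀ {m n} (f : Fin m → Fin n) → ∣ image f ∣ ℕ.≤ m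
∣image∣≤ {ℕ.zero}  {n} f = ℕₚ.≤-reflexive (∣⊥∣≡0 n)
∣image∣≤ {ℕ.suc m}     f = ℕₚ.≤-trans (∣⁅x⁆∪p∣≤1+∣p∣ (f zero) _) (ℕ.s≤s (∣image∣≤ (f ∘ suc)))

-- Removing `f zero` from `p` lowers its size and, by injectivity, keeps all other values of `f`.
injection⇒≤∣∣ : ∀ {m n} (f : Fin m → Fin n) → Injective _≡_ _≡_ f →
                ∀ {p} → (∀ i → f i ∈ p) → m ℕ.≤ ∣ p ∣
injection⇒≤∣∣ {ℕ.zero}  f inj f∈ = ℕ.z≤n
injection⇒≤∣∣ {ℕ.suc m} f inj {p} f∈ = ℕₚ.≤-trans
  (ℕ.s≤s (injection⇒≤∣∣ (f ∘ suc) (suc-injective ∘ inj) {p Subset.- f zero}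
    λ i → x∈p∧x≢y⇒x∈p-y (f∈ (suc i)) λ eq → contradiction (inj {suc i} {zero} eq) λ ()))
  (x∈p⇒∣p-x∣<∣p∣ (f∈ zero))

-- Independence numbers of bags

∈-allSubsets : ∀ {n} (p : Subset n) → p ∈ₗ allSubsets n
∈-allSubsets []                  = here refl
∈-allSubsets (Subset.outside ∷ p) = ∈-++⁺ˡ (∈-map⁺ _ (∈-allSubsets p))
∈-allSubsets (Subset.inside  ∷ p) = ∈-++⁺ʳ _ (∈-map⁺ _ (∈-allSubsets p))

module _ (G : Graph) where
  open Graph G using (order)

  ∣S∣≤α : ∀ {S X : Subset order} → S ⊆ X → Independent G S → ∣ S ∣ ℕ.≤ α[ G ] X
  ∣S∣≤α {S} {X} S⊆X ind = v≤max⁺ 0 _ (inj₂ (lose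
    (∈-map⁺ ∣_∣ (∈-filter⁺ (λ S → (S ⊆? X) ×-dec independent? G S) (∈-allSubsets S) (S⊆X , ind)))
    ℕₚ.≤-refl))

  α≤∣X∣ : ∀ (X : Subset order) → α[ G ] X ℕ.≤ ∣ X ∣
  α≤∣X∣ X = max≤v⁺ ℕ.z≤n (All.map⁺ (All.map (p⊆q⇒∣p∣≤∣q∣ ∘ proj₁)
    (All.all-filter (λ S → (S ⊆? X) ×-dec independent? G S) (allSubsets order))))

module _ {G : Graph} (𝒯 : TreeDecomposition G) where
  open TreeDecomposition 𝒯

  ∣bag∣≤maxBagSize : ∀ t → ∣ bag t ∣ ℕ.≤ maxBagSize 𝒯
  ∣bag∣≤maxBagSize t = v≤max⁺ 0 _ (inj₂ (lose (∈-map⁺ _ (∈-allFin t)) ℕₚ.≤-refl))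

  α[bag]≤independenceNumber : ∀ t → α[ G ] (bag t) ℕ.≤ independenceNumber 𝒯
  α[bag]≤independenceNumber t = v≤max⁺ 0 _ (inj₂ (lose (∈-map⁺ _ (∈-allFin t)) ℕₚ.≤-refl))

  maxBagSize≤ : ∀ {n} → (∀ t → ∣ bag t ∣ ℕ.≤ n) → maxBagSize 𝒯 ℕ.≤ n
  maxBagSize≤ bound = max≤v⁺ ℕ.z≤n (All.map⁺ {xs = allFin _} (All.tabulate λ {t} _ → bound t))

  -- An independent subset of a bag is no larger than the bag. This yields the general inequality
  -- and also turns lower bounds on the independence number into lower bounds on the width.
  independenceNumber≤maxBagSize : independenceNumber 𝒯 ℕ.≤ maxBagSize 𝒯
  independenceNumber≤maxBagSize = max≤v⁺ ℕ.z≤n (All.map⁺ {xs = allFin _} (All.tabulate λ {t} _ →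
    ℕₚ.≤-trans (α≤∣X∣ G (bag t)) (∣bag∣≤maxBagSize t)))

  independentFamily : ∀ {m} (f : Fin m → Graph.Vertex G) → Injective _≡_ _≡_ f →
                      (∀ i j → ¬ Graph._~_ G (f i) (f j)) →
                      (∃ λ t → ∀ i → f i ∈ bag t) → m ℕ.≤ independenceNumber 𝒯
  independentFamily f inj ind (t , f∈) =
    ℕₚ.≤-trans (injection⇒≤∣∣ f inj (image⁺ f))
      (ℕₚ.≤-trans (∣S∣≤α G image⊆bag independent) (α[bag]≤independenceNumber t))
    where
    image⊆bag : image f ⊆ bag t
    image⊆bag x∈ with image⁻ f x∈
    ... | i , refl = f∈ i

    independent : Independent G (image f)
    independent u v u∈ v∈ with image⁻ f u∈ | image⁻ f v∈
    ... | i , refl | j , refl = ind i j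

  NodesContaining : Graph.Vertex G → Pred (Graph.Vertex tree) 0ℓ
  NodesContaining u t = u ∈ bag t

  nodesContaining? : ∀ u → Decidable (NodesContaining u)
  nodesContaining? u t = u ∈? bag t

  -- Passes from walks on nodes paired with membership proofs to walks in the tree whose steps carry
  -- those proofs.
  nodesContaining-connected : ∀ u → ConnectedSet (Graph._~_ tree) (NodesContaining u)
  nodesContaining-connected u x∈ y∈ =
    Star.gmap proj₁ (λ {(_ , p)} {(_ , q)} r → p , r , q) (bagsConnected u (_ , x∈) (_ , y∈))

  ShareBag : Rel (Graph.Vertex G) 0ℓ
  ShareBag u v = ∃ (NodesContaining u ∩ NodesContaining v)

  -- Makes the case split on hubs sharing bags constructive.
  shareBag? : ∀ u v → Dec (ShareBag u v)
  shareBag? u v = any? λ t → nodesContaining? u t ×-dec nodesContaining? v t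

  commonBag : ∀ {m} (f : Fin m → Graph.Vertex G) →
              (∀ i j → ShareBag (f i) (f j)) → ∃ λ t → ∀ i → f i ∈ bag t
  commonBag f = helly isTree (NodesContaining ∘ f) (nodesContaining? ∘ f) (nodesContaining-connected ∘ f)

-- Stars

module _ (n : ℕ) where

  StarAdjacent : Rel (Fin (ℕ.suc n)) 0ℓ
  StarAdjacent zero    zero    = ⊥
  StarAdjacent zero    (suc _) = ⊤
  StarAdjacent (suc _) zero    = ⊤
  StarAdjacent (suc _) (suc _) = ⊥

  starGraph : Graph
  starGraph = record
    { order = ℕ.suc n
    ; _~_   = StarAdjacent
    ; _~?_  = λ { zero zero → no id ; zero (suc _) → yes tt ; (suc _) zero → yes tt ; (suc _) (suc _) → no id }
    ; sym   = λ { {zero} {suc _} _ → tt ; {suc _} {zero} _ → tt }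
    ; irrefl = λ { {zero} refl () ; {suc _} refl () }
    }

  starTree : IsTree starGraph
  starTree = record { nonempty = zero ; connected = λ x y → toCentre x ◅◅ fromCentre y ; acyclic = acyclic }
    where
    toCentre : ∀ x → Star StarAdjacent x zero
    toCentre zero    = ε
    toCentre (suc _) = tt ◅ ε

    fromCentre : ∀ x → Star StarAdjacent zero x
    fromCentre zero    = ε
    fromCentre (suc _) = tt ◅ ε

    -- Centre and leaves alternate along a walk, so a closed one of length at least three repeats
    -- the centre or would need two adjacent leaves.
    acyclic : ¬ Cycle starGraph
    acyclic record { rest = [] ; long = () }
    acyclic record { rest = _ ∷ [] ; long = ℕ.s≤s () }
    acyclic record { base = zero ; rest = zero ∷ _ ∷ _ ; closed = () ∷ _ }
    acyclic record { base = zero ; rest = suc _ ∷ suc _ ∷ _ ; closed = _ ∷ () ∷ _ }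
    acyclic record { base = zero ; rest = suc _ ∷ zero ∷ _ ; distinct = (_ ∷ 0≢0 ∷ _) ∷ _ } = 0≢0 refl
    acyclic record { base = suc _ ; rest = suc _ ∷ _ ∷ _ ; closed = () ∷ _ }
    acyclic record { base = suc _ ; rest = zero ∷ zero ∷ _ ; closed = _ ∷ () ∷ _ }
    acyclic record { base = suc _ ; rest = zero ∷ suc _ ∷ [] ; closed = _ ∷ _ ∷ () ∷ _ }
    acyclic record { base = suc _ ; rest = zero ∷ suc _ ∷ suc _ ∷ _ ; closed = _ ∷ _ ∷ () ∷ _ }
    acyclic record { base = suc _ ; rest = zero ∷ suc _ ∷ zero ∷ _ ; distinct = _ ∷ (_ ∷ 0≢0 ∷ _) ∷ _ } = 0≢0 refl

-- Hubs and links: link s is joined to the hubs e₁ s and e₂ s.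

module HubsAndLinks (k n : ℕ) (e₁ e₂ : Fin n → Fin k) where

  End : Fin k → Fin n → Set
  End i s = i ≡ e₁ s ⊎ i ≡ e₂ s

  end? : ∀ i s → Dec (End i s)
  end? i s = (i ≟ e₁ s) ⊎-dec (i ≟ e₂ s)

  Adjacent : Rel (Fin k ⊎ Fin n) 0ℓ
  Adjacent (inj₁ _) (inj₁ _) = ⊥
  Adjacent (inj₁ i) (inj₂ s) = End i s
  Adjacent (inj₂ s) (inj₁ i) = End i s
  Adjacent (inj₂ _) (inj₂ _) = ⊥

  adjacent? : ∀ x y → Dec (Adjacent x y)
  adjacent? (inj₁ _) (inj₁ _) = no id
  adjacent? (inj₁ i) (inj₂ s) = end? i s
  adjacent? (inj₂ s) (inj₁ i) = end? i s
  adjacent? (inj₂ _) (inj₂ _) = no id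

  adjacent-sym : ∀ x y → Adjacent x y → Adjacent y x
  adjacent-sym (inj₁ _) (inj₂ _) e = e
  adjacent-sym (inj₂ _) (inj₁ _) e = e

  adjacent-irrefl : ∀ x → ¬ Adjacent x x
  adjacent-irrefl (inj₁ _) ()
  adjacent-irrefl (inj₂ _) ()

  graph : Graph
  graph = record
    { order  = k ℕ.+ n
    ; _~_    = Adjacent on splitAt k
    ; _~?_   = λ u v → adjacent? (splitAt k u) (splitAt k v)
    ; sym    = λ {u} {v} → adjacent-sym (splitAt k u) (splitAt k v)
    ; irrefl = λ { {u} refl → adjacent-irrefl (splitAt k u) }
    }

  open Graph graph using (Vertex; _~_)

  hub : Fin k → Vertex
  hub i = i ↑ˡ n

  link : Fin n → Vertex
  link s = k ↑ʳ s

  hub≢link : ∀ {i s} → hub i ≢ link s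
  hub≢link {i} {s} eq
    with () ← trans (sym (splitAt-↑ˡ k i n)) (trans (cong (splitAt k) eq) (splitAt-↑ʳ k n s))

  hub≁hub : ∀ i j → ¬ (hub i ~ hub j)
  hub≁hub i j rewrite splitAt-↑ˡ k i n | splitAt-↑ˡ k j n = id

  link≁link : ∀ s s′ → ¬ (link s ~ link s′)
  link≁link s s′ rewrite splitAt-↑ʳ k n s | splitAt-↑ʳ k n s′ = id

  hub~link : ∀ {i s} → End i s → hub i ~ link s
  hub~link {i} {s} e rewrite splitAt-↑ˡ k i n | splitAt-↑ʳ k n s = e

  -- Indexing by `Fin 3` bounds a leaf bag by three through `∣image∣≤`, even if the two ends
  -- coincide.
  corner : Fin n → Fin 3 → Vertex
  corner s = Vec.lookup (hub (e₁ s) ∷ hub (e₂ s) ∷ link s ∷ [])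

  bag : Fin (ℕ.suc n) → Subset (k ℕ.+ n)
  bag zero    = image hub
  bag (suc s) = image (corner s)

  end∈bag : ∀ {i s} → End i s → hub i ∈ bag (suc s)
  end∈bag {s = s} (inj₁ refl) = image⁺ (corner s) zero
  end∈bag {s = s} (inj₂ refl) = image⁺ (corner s) (suc zero)

  link∈bag : ∀ s → link s ∈ bag (suc s)
  link∈bag s = image⁺ (corner s) (suc (suc zero))

  -- The centre holds hubs only, and each other leaf holds a different link. Hence the subtree of a
  -- link is a single node.
  link∈bag⁻ : ∀ {s} t → link s ∈ bag t → t ≡ suc s
  link∈bag⁻ zero    s∈ = contradiction (sym (proj₂ (image⁻ hub s∈))) hub≢link
  link∈bag⁻ (suc t) s∈ with image⁻ (corner t) s∈
  ... | zero           , eq = contradiction (sym eq) hub≢link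
  ... | suc zero       , eq = contradiction (sym eq) hub≢link
  ... | suc (suc zero) , eq = cong suc (sym (↑ʳ-injective k _ _ eq))

  decomposition : TreeDecomposition graph
  decomposition = record
    { tree          = starGraph n
    ; isTree        = starTree n
    ; bag           = bag
    ; vertexCovered = covered
    ; edgeCovered   = edgeCovered
    ; bagsConnected = bagsConnected
    }
    where
    covered : ∀ u → ∃ λ t → u ∈ bag t
    covered u with splitAt k u in eq
    ... | inj₁ i rewrite sym (splitAt⁻¹-↑ˡ eq) = zero , image⁺ hub i
    ... | inj₂ s rewrite sym (splitAt⁻¹-↑ʳ eq) = suc s , link∈bag s

    edgeCovered : ∀ {u v} → u ~ v → ∃ λ t → u ∈ bag t × v ∈ bag t
    edgeCovered {u} {v} e with splitAt k u in eq | splitAt k v in eq′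
    ... | inj₁ i | inj₂ s rewrite sym (splitAt⁻¹-↑ˡ eq) | sym (splitAt⁻¹-↑ʳ eq′) = suc s , end∈bag e , link∈bag s
    ... | inj₂ s | inj₁ i rewrite sym (splitAt⁻¹-↑ʳ eq) | sym (splitAt⁻¹-↑ˡ eq′) = suc s , link∈bag s , end∈bag e

    NodesOf : Vertex → Set
    NodesOf u = Σ (Fin (ℕ.suc n)) λ t → u ∈ bag t

    -- Nodes here carry membership proofs, so even the empty walk needs proof irrelevance.
    same : ∀ {u t} (p q : u ∈ bag t) → Star (StarAdjacent n on (proj₁ {B = λ t → u ∈ bag t})) (t , p) (t , q)
    same {t = t} p q = subst (λ r → Star _ (t , p) (t , r)) ([]=-irrelevant p q) ε

    bagsConnected : ∀ u → Connected {NodesOf u} (StarAdjacent n on proj₁)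
    bagsConnected u (t , p) (t′ , q) with splitAt k u in eq
    bagsConnected u (t , p) (t′ , q) | inj₂ s rewrite sym (splitAt⁻¹-↑ʳ eq)
      with refl ← link∈bag⁻ t p | refl ← link∈bag⁻ t′ q = same p q
    -- Every hub lies in the central bag, so its nodes are joined through the centre.
    bagsConnected u (t , p) (t′ , q) | inj₁ i rewrite sym (splitAt⁻¹-↑ˡ eq) = toCentre t p ◅◅ fromCentre t′ q
      where
      centre : NodesOf (hub i)
      centre = zero , image⁺ hub i

      toCentre : ∀ t p → Star (StarAdjacent n on proj₁) (t , p) centre
      toCentre zero    p = same p _
      toCentre (suc _) p = tt ◅ ε

      fromCentre : ∀ t p → Star (StarAdjacent n on proj₁) centre (t , p)
      fromCentre zero    p = same _ p
      fromCentre (suc _) p = tt ◅ ε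

  -- The hypothesis takes a link as argument, so it is vacuous without links; this admits `k` equal
  -- to 1.
  maxBagSize≤k : (Fin n → 3 ℕ.≤ k) → maxBagSize decomposition ℕ.≤ k
  maxBagSize≤k 3≤k = maxBagSize≤ decomposition λ
    { zero → ∣image∣≤ hub ; (suc s) → ℕₚ.≤-trans (∣image∣≤ (corner s)) (3≤k s) }

  -- As many common links as there are hubs, so that either case of the lower bound gives `k`
  -- independent vertices in one bag.
  record Parallel (i j : Fin k) : Set where
    field
      at         : Fin k → Fin n
      injective  : Injective _≡_ _≡_ at
      end₁       : ∀ l → End i (at l)
      end₂       : ∀ l → End j (at l)

  k≤independenceNumber : (∀ {i j} → i ≢ j → Parallel i j) →
                         ∀ 𝒯 → k ℕ.≤ independenceNumber {graph} 𝒯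
  k≤independenceNumber parallel 𝒯 with all? (λ i → all? λ j → shareBag? 𝒯 (hub i) (hub j))
  ... | yes share = independentFamily 𝒯 hub (↑ˡ-injective n _ _) hub≁hub (commonBag 𝒯 hub share)
  ... | no ¬share
    -- The failed finite check yields explicit hubs `i` and `j` without a common bag.
    with i , ¬shareᵢ  ← ¬∀⟶∃¬ k _ (λ i → all? λ j → shareBag? 𝒯 (hub i) (hub j)) ¬share
    with j , ¬shareᵢⱼ ← ¬∀⟶∃¬ k _ (λ j → shareBag? 𝒯 (hub i) (hub j)) ¬shareᵢ
    = independentFamily 𝒯 (link ∘ at) (injective ∘ ↑ʳ-injective k _ _) (λ l l′ → link≁link _ _)
        (commonBag 𝒯 (link ∘ at) λ l l′ →
          crossing-meet (TreeDecomposition.isTree 𝒯) (nodesContaining? 𝒯 _) (nodesContaining? 𝒯 _)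
            (conn (hub i)) (conn (hub j)) (conn _) (conn _) ¬shareᵢⱼ
            (edge (end₁ l)) (edge (end₂ l)) (edge (end₁ l′)) (edge (end₂ l′)))
    where
    open TreeDecomposition 𝒯 using (vertexCovered; edgeCovered)

    -- Each hub is in some bag and so shares one with itself.
    i≢j : i ≢ j
    i≢j refl = let t , i∈ = vertexCovered (hub i) in ¬shareᵢⱼ (t , i∈ , i∈)

    open Parallel (parallel i≢j)

    conn = nodesContaining-connected 𝒯

    edge : ∀ {i s} → End i s → ShareBag 𝒯 (hub i) (link s)
    edge {i} {s} e = edgeCovered {hub i} {link s} (hub~link e)

  -- For the star decomposition, `k` bounds the independence number from below and the largest bag
  -- from above, so both equal `k`; the lower bounds hold for every decomposition.
  tree-α≡k∧tw≡k-1 : (Fin n → 3 ℕ.≤ k) → (∀ {i j} → i ≢ j → Parallel i j) →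
                    IsTreeAlpha graph k × IsTreewidth graph (+ k ℤ.- 1ℤ)
  tree-α≡k∧tw≡k-1 3≤k parallel =
    ( (decomposition , ℕₚ.≤-antisym (ℕₚ.≤-trans (independenceNumber≤maxBagSize decomposition) (maxBagSize≤k 3≤k)) (k≤α decomposition))
    , k≤α )
    , ( (decomposition , cong (λ m → + m ℤ.- 1ℤ) (ℕₚ.≤-antisym (maxBagSize≤k 3≤k) (k≤maxBagSize decomposition)))
      , λ 𝒯 → ℤₚ.+-monoˡ-≤ (ℤ.- 1ℤ) (ℤ.+≤+ (k≤maxBagSize 𝒯)) )
    where
    k≤α = k≤independenceNumber parallel

    k≤maxBagSize : ∀ 𝒯 → k ℕ.≤ maxBagSize {graph} 𝒯
    k≤maxBagSize 𝒯 = ℕₚ.≤-trans (k≤α 𝒯) (independenceNumber≤maxBagSize 𝒯)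

-- Extremal graphs for each admissible `k`

sharp : ∀ k → 1 ℕ.≤ k → k ≢ 2 → Σ Graph λ G → IsTreeAlpha G k × IsTreewidth G (+ k ℤ.- 1ℤ)
-- A single vertex: one hub, no links, no pair of distinct hubs.
sharp 1 _ _ = graph , tree-α≡k∧tw≡k-1 (λ ()) λ { {zero} {zero} 0≢0 → contradiction refl 0≢0 }
  where open HubsAndLinks 1 0 (λ ()) (λ ())
sharp 2 _ 2≢2 = contradiction refl 2≢2
sharp k@(ℕ.suc (ℕ.suc (ℕ.suc _))) _ _ =
  graph , tree-α≡k∧tw≡k-1 (λ _ → ℕ.s≤s (ℕ.s≤s (ℕ.s≤s ℕ.z≤n))) λ {i} {j} _ → record
    { at        = λ l → combine (combine i j) l
    ; injective = combine-injectiveʳ (combine i j) _ (combine i j) _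
    ; end₁      = λ l → inj₁ (sym (cong proj₁ (ends-combine i j l)))
    ; end₂      = λ l → inj₂ (sym (cong proj₂ (ends-combine i j l)))
    }
  where
  -- A link encodes a triple: an ordered pair of hubs and a copy number. Distinct hubs thus get `k`
  -- links in each order, and diagonal pairs give pendant links.
  ends : Fin (k ℕ.* k ℕ.* k) → Fin k × Fin k
  ends s = remQuot k (proj₁ (remQuot k s))

  ends-combine : ∀ i j l → ends (combine (combine i j) l) ≡ (i , j)
  ends-combine i j l = trans (cong (remQuot k ∘ proj₁) (remQuot-combine (combine i j) l)) (remQuot-combine i j)

  open HubsAndLinks k (k ℕ.* k ℕ.* k) (proj₁ ∘ ends) (proj₂ ∘ ends)

width+1≡maxBagSize : ∀ {G} (𝒯 : TreeDecomposition G) → width 𝒯 ℤ.+ 1ℤ ≡ + maxBagSize 𝒯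
width+1≡maxBagSize 𝒯 = trans (ℤₚ.+-assoc (+ maxBagSize 𝒯) (ℤ.- 1ℤ) 1ℤ) (ℤₚ.+-identityʳ _)

theorem3p8 : (∀ (G : Graph) (a : ℕ) (w : ℤ) → IsTreeAlpha G a → IsTreewidth G w → + a ℤ.≤ w ℤ.+ 1ℤ)
    × (∀ (k : ℕ) → 1 ℕ.≤ k → k ≢ 2 → Σ Graph λ G → IsTreeAlpha G k × IsTreewidth G (+ k ℤ.- 1ℤ))
theorem3p8 =
  -- Here `𝒯` attains the treewidth, and `a` is at most its independence number.
  (λ { G a _ (_ , a≤) ((𝒯 , refl) , _) → subst (+ a ℤ.≤_) (sym (width+1≡maxBagSize 𝒯))
         (ℤ.+≤+ (ℕₚ.≤-trans (a≤ 𝒯) (independenceNumber≤maxBagSize 𝒯))) })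
  , sharp
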